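{- Let $\ell\ge2$. For $m\ge1$ let $\psi_m:\mathbb R^m\to\mathbb R^m$ be the affine map $\psi_m(a_1,\dots,a_m)=(a_m+1,a_1,a_2,\dots,a_{m-1})$. Let $(a_1,\dots,a_\ell)\in\mathbb Z^\ell$ with $\sum_j a_j=0$, and let $k$ be the first part of the $\ell$-core $\pi(a_1,\dots,a_\ell)$. Then $$\pi^{ -1}\circ\Phi_\ell^k\circ\pi(a_1,\dots,a_\ell)=\psi_{\ell-1}^{a_i}(a_1,\dots,\widehat{a_i},\dots,a_\ell),$$ where $a_i$ is the rightmost occurrence of the largest entry among $\{a_1,\dots,a_\ell\}$, the circumflex indicates omission, and the exponent $a_i$ denotes iteration.
   Context: An $\ell$-core is a partition with no hook length divisible by $\ell$. $\mathcal C_\ell^k$ is the set of $\ell$-cores with first part $k$, and $\mathcal C_{\ell-1}^{\le k}$ the set of $(\ell-1)$-cores with first part $\le k$. Abaci. An ($\ell$-)abacus has runners (columns) $0,\dots,\ell-1$ and levels (rows) $r\in\mathbb Z$; the entry on runner $j$, level $r$ is the integer $r\ell+j$. Some entries are beads, the others gaps, such that all sufficiently small integers are beads and all sufficiently large ones are gaps. An abacus determines a partition: its parts are, for each bead, the number of gaps preceding it in the linear order of the integers (discarding zeros). An abacus is flush if on every runner no bead is preceded by a gap of the same runner; it is balanced if the sum over all runners of the largest level containing a bead is $0$. A partition is an $\ell$-core iff its abaci are flush, and each $\ell$-core has exactly one balanced flush abacus. $\pi$ is the bijection from $\{(a_1,\dots,a_\ell)\in\mathbb Z^\ell:\sum a_j=0\}$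 to the set of $\ell$-cores sending $(a_1,\dots,a_\ell)$ to the partition of the balanced flush $\ell$-abacus whose runner $j-1$ has beads exactly at levels $\le a_j$, $1\le j\le\ell$. The same letter $\pi$ is used for $\ell-1$ in place of $\ell$ (so $\pi^{ -1}$ in the claim takes $(\ell-1)$-cores to vectors in $\mathbb Z^{\ell-1}$ with sum $0$). $\Phi_\ell^k:\mathcal C_\ell^k\to\mathcal C_{\ell-1}^{\le k}$ is the bijection: given any abacus of $\lambda\in\mathcal C_\ell^k$, delete the whole runner containing the largest bead, and place the remaining runners in order (levels unchanged) into an $(\ell-1)$-abacus; $\Phi_\ell^k(\lambda)$ is the corresponding $(\ell-1)$-core (independent of the choice of abacus). -}

module Defs where

open import Data.Fin.Base as Fin using (Fin; toℕ; fromℕ<; punchIn)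
open import Data.Fin.Properties using (toℕ<n)
open import Data.Integer.Base
  using (ℤ; +_; -[1+_]; 0ℤ; 1ℤ; _+_; _-_; _*_; _≤_; _<_; _⊓_; _⊔_; +<+)
  renaming (suc to sucℤ)
open import Data.Integer.DivMod
  using (_/ℕ_; _%ℕ_; n%ℕd<d; [n/ℕd]*d≤n; n<s[n/ℕd]*d)
import Data.Integer.Properties as ℤ
open import Data.List.Base
  using (List; []; _∷_; length; lookup; drop; map; filter; downFrom)
open import Data.List.Relation.Unary.All using (All)
open import Data.List.Relation.Unary.Linked using (Linked)
open import Data.Nat.Base as ℕ using (ℕ; suc; NonZero; _∸_)
open import Data.Nat.Divisibility using (_∣_)
import Data.Nat.Properties as ℕ
open import Data.Product.Base using (_×_; _,_)
open import Data.Vec.Base as Vec using (Vec; []; _∷_)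
open import Level using (0ℓ)
open import Relation.Binary.PropositionalEquality.Core
  using (_≡_; _≢_; refl)
open import Relation.Nullary using (¬_; Dec; ¬?)
open import Relation.Unary using (Pred; Decidable)

IsPartition : List ℕ → Set
IsPartition ps = Linked ℕ._≥_ ps × All (0 ℕ.<_) ps

firstPart : List ℕ → ℕ
firstPart []      = 0
firstPart (p ∷ _) = p

-- Arm + leg + 1 for the cell in row i and column j of the Young diagram,
-- both counted from 0; meaningful for j < lookup ps i.
hookLength : (ps : List ℕ) → Fin (length ps) → ℕ → ℕ
hookLength ps i j = arm ℕ.+ leg ℕ.+ 1
  where
  arm = lookup ps i ∸ suc j
  leg = length (filter (j ℕ.<?_) (drop (suc (toℕ i)) ps))

IsCore : ℕ → List ℕ → Set
IsCore ℓ ps =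
  IsPartition ps ×
  (∀ i j → j ℕ.< lookup ps i → ¬ (ℓ ∣ hookLength ps i j))

𝒞[_,_] : ℕ → ℕ → Pred (List ℕ) 0ℓ
𝒞[ ℓ , k ] ps = IsCore ℓ ps × firstPart ps ≡ k

𝒞[_,≤_] : ℕ → ℕ → Pred (List ℕ) 0ℓ
𝒞[ ℓ ,≤ k ] ps = IsCore ℓ ps × firstPart ps ℕ.≤ k

module _ (ℓ : ℕ) .{{_ : NonZero ℓ}} where

  entry : ℤ → Fin ℓ → ℤ
  entry r j = r * + ℓ + + toℕ j

  -- Division rounds towards -∞, so that x ≡ entry (level x) (runner x).
  level : ℤ → ℤ
  level x = x /ℕ ℓ

  runner : ℤ → Fin ℓ
  runner x = fromℕ< (n%ℕd<d x ℓ)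

-- The index ℓ fixes only the arrangement of the integers into runners and
-- levels.  Decidability of the bead set is no restriction classically; the
-- bounds are arbitrary witnesses for the two finiteness conditions.
record Abacus (ℓ : ℕ) : Set₁ where
  field
    Bead      : Pred ℤ 0ℓ
    bead?     : Decidable Bead
    lo hi     : ℤ
    beads-low : ∀ x → x < lo → Bead x
    gaps-high : ∀ x → hi ≤ x → ¬ Bead x

open Abacus public

positivePart : ℤ → ℕ
positivePart (+ d)      = d
positivePart (-[1+ _ ]) = 0

-- The integers x with m ≤ x < n, in decreasing order.
window : ℤ → ℤ → List ℤ
window m n = map (λ d → m + + d) (downFrom (positivePart (n - m)))

gap? : ∀ {ℓ} (A : Abacus ℓ) (x : ℤ) → Dec (¬ Bead A x)
gap? A x = ¬? (bead? A x)

-- Every gap is ≥ lo, so this is the total number of gaps preceding x.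
gapsBefore : ∀ {ℓ} → Abacus ℓ → ℤ → ℕ
gapsBefore A x = length (filter (gap? A) (window (lo A) x))

-- Every bead is < hi, and the beads < lo contribute only zeros.
partition : ∀ {ℓ} → Abacus ℓ → List ℕ
partition A =
  filter (0 ℕ.<?_) (map (gapsBefore A) (filter (bead? A) (window (lo A) (hi A))))

IsLargestBead : ∀ {ℓ} → Abacus ℓ → ℤ → Set
IsLargestBead A b = Bead A b × (∀ x → Bead A x → x ≤ b)

module _ {ℓ : ℕ} .{{_ : NonZero ℓ}} where

  open ℤ.≤-Reasoning

  level-below : ∀ x r → x < r * + ℓ → level ℓ x < r
  level-below x r x<rℓ = ℤ.*-cancelʳ-<-nonNeg (+ ℓ)
    (ℤ.≤-<-trans ([n/ℕd]*d≤n x ℓ) x<rℓ)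

  level-above : ∀ x r → r * + ℓ ≤ x → r ≤ level ℓ x
  level-above x r rℓ≤x = ℤ.≮⇒≥ λ q<r → ℤ.<-irrefl {x} refl (begin-strict
    x                      <⟨ n<s[n/ℕd]*d x ℓ ⟩
    sucℤ (level ℓ x) * + ℓ ≤⟨ ℤ.*-monoʳ-≤-nonNeg (+ ℓ) (ℤ.i<j⇒suc[i]≤j q<r) ⟩
    r * + ℓ                ≤⟨ rℓ≤x ⟩
    x                      ∎)

  entry-below : ∀ r s (j : Fin ℓ) → r < s → entry ℓ r j < s * + ℓ
  entry-below r s j r<s = begin-strict
    r * + ℓ + + toℕ j <⟨ ℤ.+-monoʳ-< (r * + ℓ) (+<+ (toℕ<n j)) ⟩
    r * + ℓ + + ℓ     ≡⟨ ℤ.+-comm (r * + ℓ) (+ ℓ) ⟩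
    + ℓ + r * + ℓ     ≡⟨ ℤ.suc-* r (+ ℓ) ⟨
    sucℤ r * + ℓ      ≤⟨ ℤ.*-monoʳ-≤-nonNeg (+ ℓ) (ℤ.i<j⇒suc[i]≤j r<s) ⟩
    s * + ℓ           ∎

  entry-above : ∀ r s (j : Fin ℓ) → s ≤ r → s * + ℓ ≤ entry ℓ r j
  entry-above r s j s≤r = begin
    s * + ℓ           ≤⟨ ℤ.*-monoʳ-≤-nonNeg (+ ℓ) s≤r ⟩
    r * + ℓ           ≤⟨ ℤ.i≤i+j (r * + ℓ) (+ toℕ j) ⟩
    r * + ℓ + + toℕ j ∎

-- punchIn i lists the runners other than i in order.
deleteRunner : ∀ {m} .{{_ : NonZero m}} → Fin (suc m) → Abacus (suc m) → Abacus m
deleteRunner {m} i A = record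
  { Bead      = λ y → Bead A (old y)
  ; bead?     = λ y → bead? A (old y)
  ; lo        = loLevel * + m
  ; hi        = hiLevel * + m
  ; beads-low = λ y y<lo → beads-low A (old y)
      (ℤ.<-≤-trans (entry-below _ loLevel _ (level-below y loLevel y<lo))
        ([n/ℕd]*d≤n (lo A) (suc m)))
  ; gaps-high = λ y hi≤y → gaps-high A (old y)
      (ℤ.≤-trans (ℤ.<⇒≤ (n<s[n/ℕd]*d (hi A) (suc m)))
        (entry-above _ hiLevel _ (level-above y hiLevel hi≤y)))
  }
  where
  old : ℤ → ℤ
  old y = entry (suc m) (level m y) (punchIn i (runner m y))

  loLevel = level (suc m) (lo A)
  hiLevel = sucℤ (level (suc m) (hi A))

sum : ∀ {m} → Vec ℤ m → ℤ
sum = Vec.foldr′ _+_ 0ℤ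

minimum maximum : ∀ {m} → Vec ℤ m → ℤ
minimum = Vec.foldr′ _⊓_ 0ℤ
maximum = Vec.foldr′ _⊔_ 0ℤ

minimum≤ : ∀ {m} (a : Vec ℤ m) j → minimum a ≤ Vec.lookup a j
minimum≤ (x ∷ a) Fin.zero    = ℤ.i⊓j≤i x (minimum a)
minimum≤ (x ∷ a) (Fin.suc j) = ℤ.≤-trans (ℤ.i⊓j≤j x (minimum a)) (minimum≤ a j)

≤maximum : ∀ {m} (a : Vec ℤ m) j → Vec.lookup a j ≤ maximum a
≤maximum (x ∷ a) Fin.zero    = ℤ.i≤i⊔j x (maximum a)
≤maximum (x ∷ a) (Fin.suc j) = ℤ.≤-trans (≤maximum a j) (ℤ.i≤j⊔i x (maximum a))

-- The flush abacus whose runner j has beads exactly at the levels ≤ a_j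
-- (runners and coordinates both counted from 0); it is balanced iff
-- sum a ≡ 0.
flushAbacus : ∀ {m} .{{_ : NonZero m}} → Vec ℤ m → Abacus m
flushAbacus {m} a = record
  { Bead      = λ x → level m x ≤ Vec.lookup a (runner m x)
  ; bead?     = λ x → level m x ℤ.≤? Vec.lookup a (runner m x)
  ; lo        = minimum a * + m
  ; hi        = sucℤ (maximum a) * + m
  ; beads-low = λ x x<lo → ℤ.≤-trans (ℤ.<⇒≤ (level-below x (minimum a) x<lo))
      (minimum≤ a (runner m x))
  ; gaps-high = λ x hi≤x → ℤ.<⇒≱ (ℤ.≤-<-trans (≤maximum a (runner m x))
      (ℤ.suc[i]≤j⇒i<j (level-above x (sucℤ (maximum a)) hi≤x)))
  }

-- Of interest for sum a ≡ 0 only.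
π : ∀ {m} .{{_ : NonZero m}} → Vec ℤ m → List ℕ
π a = partition (flushAbacus a)

-- v ≡π⁻¹ μ states v = π⁻¹(μ): v is the one and only vector with sum 0 that
-- π sends to μ.
record _≡π⁻¹_ {m} .{{_ : NonZero m}} (v : Vec ℤ m) (μ : List ℕ) : Set where
  field
    sum≡0  : sum v ≡ 0ℤ
    π≡     : π v ≡ μ
    unique : ∀ w → sum w ≡ 0ℤ → π w ≡ μ → w ≡ v

-- Φ ℓ-1 k κ μ is the graph of Φ_ℓ^k : 𝒞_ℓ^k → 𝒞_{ℓ-1}^{≤k}, that is,
-- μ = Φ_ℓ^k(κ).  All abaci of κ are required to yield μ; this is not
-- vacuous, since every partition has an abacus and every abacus has a
-- largest bead.
record Φ (m : ℕ) .{{_ : NonZero m}} (k : ℕ) (κ μ : List ℕ) : Set₁ where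
  field
    source : 𝒞[ suc m , k ] κ
    target : 𝒞[ m ,≤ k ] μ
    delete : ∀ (A : Abacus (suc m)) → partition A ≡ κ →
             ∀ b → IsLargestBead A b →
             partition (deleteRunner (runner (suc m) b) A) ≡ μ

-- The restriction to ℤ^(n+1) of the affine map of ℝ^(n+1).
ψ : ∀ {n} → Vec ℤ (suc n) → Vec ℤ (suc n)
ψ a = (Vec.last a + 1ℤ) ∷ Vec.init a

IsRightmostMaximum : ∀ {m} → Vec ℤ m → Fin m → Set
IsRightmostMaximum a i =
  (∀ j → Vec.lookup a j ≤ Vec.lookup a i) ×
  (∀ j → i Fin.< j → Vec.lookup a j ≢ Vec.lookup a i)

module Submission where

-- A partition together with a charge determines the beads of an abacus, so all
-- abaci of π(a) are translates of the flush abacus of a.  Translation by one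
-- turns the flush abacus of a into that of ψ(a): the last runner becomes the
-- first one, one level higher.  Hence every abacus of π(a) is flush, with vector
-- b in the ψ-orbit of a.  Its largest bead lies on the runner of the rightmost
-- maximum of b, and deleting that runner omits this entry.  One step of ψ on b
-- amounts, after the omission, to one step of ψ or to none; in either case the
-- partition does not change.  So Φ(π(a)) is the partition of a with a_i omitted.
-- That vector has sum -a_i and each ψ raises the sum by 1, so ψ^{a_i} reaches the
-- balanced vector of the orbit, which is unique for the same reason.

open import Defs
import Algebra.Properties.AbelianGroup as AbelianGroup
open import Data.Bool.Base using (Bool; true; false; if_then_else_)
open import Data.Empty using (⊥-elim)
open import Data.Fin.Base as Fin using (Fin; toℕ; fromℕ; inject₁; punchIn)
import Data.Fin.Properties as Fin
open import Data.Fin.Relation.Unary.Top using (view; ‵fromℕ; ‵inject₁)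
open import Data.Integer.Base using (ℤ; +_; -[1+_]; 0ℤ; 1ℤ; ∣_∣; +≤+; +<+) renaming (suc to sucℤ)
open import Data.Integer.DivMod using (a≡a%ℕn+[a/ℕn]*n; [n/ℕd]*d≤n; n%ℕd<d)
import Data.Integer.Properties as ℤ
open import Data.List.Base as List using (List; []; _∷_; length; filter; map; downFrom)
import Data.List.Properties as List
open import Data.List.Relation.Unary.All as All using (All; []; _∷_)
open import Data.List.Relation.Unary.Linked using (Linked; []; [-]; _∷_)
open import Data.Nat.Base as ℕ using (ℕ; zero; suc; NonZero)
open import Data.Nat.Divisibility using (_∣_; divides)
open import Data.Nat.GeneralisedArithmetic using (iterate)
import Data.Nat.Properties as ℕ
open import Data.Product using (∃-syntax; _×_; _,_; proj₁; proj₂)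
open import Data.Sum.Base using (_⊎_; inj₁; inj₂)
open import Data.Vec.Base as Vec using (Vec; []; _∷_; _∷ʳ_; lookup; removeAt; init; last)
import Data.Vec.Properties as Vec
open import Function.Base using (_∘_; id)
open import Function.Bundles using (_⇔_; mk⇔; module Equivalence)
open import Function.Properties.Equivalence using (⇔-isEquivalence)
open import Level using (0ℓ)
open import Relation.Binary.Definitions using (tri<; tri≈; tri>)
open import Relation.Binary.PropositionalEquality
open import Relation.Binary.Structures using (IsEquivalence)
open import Relation.Nullary using (¬_; does; yes; no; contradiction)
open import Relation.Nullary.Decidable using (dec-true; dec-false; does-⇔)

-- Sequences of beads (true) and gaps (false), read up to a bound n

module _ where

  open import Data.Nat.Base
    using (_+_; _∸_; _≤_; _<_; _≥_; _≤′_; ≤′-refl; ≤′-step; z≤n; z<s; s≤s; s≤s⁻¹)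
  open import Data.Nat.Properties
  open import Data.Nat.Tactic.RingSolver using (solve-∀)

  gapCount beadCount : (ℕ → Bool) → ℕ → ℕ
  gapCount f zero = 0
  gapCount f (suc n) = if f n then gapCount f n else suc (gapCount f n)
  beadCount f zero = 0
  beadCount f (suc n) = if f n then suc (beadCount f n) else beadCount f n

  -- A bead below every gap yields zero. Dropping it here matches the filter in `partition`.
  consPositive : ℕ → List ℕ → List ℕ
  consPositive zero    ps = ps
  consPositive (suc p) ps = suc p ∷ ps

  parts : (ℕ → Bool) → ℕ → List ℕ
  parts f zero    = []
  parts f (suc n) = if f n then consPositive (gapCount f n) (parts f n) else parts f n

  -- Padding with zeros gives a part to every bead, also to the infinitely many below the first gap,
  -- so that each bead has an index in `bead⇔index`.
  part : List ℕ → ℕ → ℕ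
  part []       _       = 0
  part (p ∷ ps) zero    = p
  part (p ∷ ps) (suc i) = part ps i

  gapCount+beadCount : ∀ f n → gapCount f n + beadCount f n ≡ n
  gapCount+beadCount f zero = refl
  gapCount+beadCount f (suc n) with f n
  ... | true  = trans (+-suc _ _) (cong suc (gapCount+beadCount f n))
  ... | false = cong suc (gapCount+beadCount f n)

  parts≤gapCount : ∀ f n → All (_≤ gapCount f n) (parts f n)
  parts≤gapCount f zero = []
  parts≤gapCount f (suc n) with parts≤gapCount f n
  ... | ih with f n
  ...   | false = All.map m≤n⇒m≤1+n ih
  ...   | true with gapCount f n
  ...     | zero  = ih
  ...     | suc _ = ≤-refl ∷ ih

  consPositive-positive : ∀ p {ps} → All (0 <_) ps → All (0 <_) (consPositive p ps)
  consPositive-positive zero    pos = pos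
  consPositive-positive (suc _) pos = z<s ∷ pos

  parts-positive : ∀ f n → All (0 <_) (parts f n)
  parts-positive f zero = []
  parts-positive f (suc n) with f n
  ... | false = parts-positive f n
  ... | true  = consPositive-positive (gapCount f n) (parts-positive f n)

  consPositive-sorted : ∀ p {ps} → All (_≤ p) ps → Linked _≥_ ps → Linked _≥_ (consPositive p ps)
  consPositive-sorted zero    ps≤p       sorted = sorted
  consPositive-sorted (suc p) []         sorted = [-]
  consPositive-sorted (suc p) (q≤p ∷ _)  sorted = q≤p ∷ sorted

  parts-sorted : ∀ f n → Linked _≥_ (parts f n)
  parts-sorted f zero = []
  parts-sorted f (suc n) with f n
  ... | false = parts-sorted f n
  ... | true  = consPositive-sorted (gapCount f n) (parts≤gapCount f n) (parts-sorted f n)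

  parts-isPartition : ∀ f n → IsPartition (parts f n)
  parts-isPartition f n = parts-sorted f n , parts-positive f n

  -- Hooks as pairs of a gap and a later bead

  filter-parts-above : ∀ f n {j} → gapCount f n ≤ j → filter (j <?_) (parts f n) ≡ []
  filter-parts-above f n G≤j =
    List.filter-none (_ <?_) (All.map (λ p≤G → ≤⇒≯ (≤-trans p≤G G≤j)) (parts≤gapCount f n))

  leg : (ℕ → Bool) → ℕ → ℕ → ℕ
  leg f n j = length (filter (j <?_) (parts f n))

  -- The gap ending the hook of a cell in the row of a bead at n, in column j, is
  -- the one with exactly j gaps before it.
  gap-of-column : ∀ f n j → j < gapCount f n →
    ∃[ y ] (f y ≡ false × y + (gapCount f n ∸ suc j + leg f n j + 1) ≡ n)
  gap-of-column f (suc n) j j<G with f n in eq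
  ... | true =
    let y , fy , y+h≡n = gap-of-column f n j j<G
    in y , fy , (begin
      y + (gapCount f n ∸ suc j + length (filter (j <?_) (consPositive (gapCount f n) (parts f n))) + 1)
        ≡⟨ cong (λ l → y + (gapCount f n ∸ suc j + l + 1)) (leg-cons (parts f n) j<G) ⟩
      y + (gapCount f n ∸ suc j + suc (leg f n j) + 1)
        ≡⟨ lemma y (gapCount f n ∸ suc j) (leg f n j) ⟩
      suc (y + (gapCount f n ∸ suc j + leg f n j + 1))
        ≡⟨ cong suc y+h≡n ⟩
      suc n ∎)
    where
    open ≡-Reasoning
    lemma : ∀ y a l → y + (a + suc l + 1) ≡ suc (y + (a + l + 1))
    lemma = solve-∀
    leg-cons : ∀ {p} ps → j < p →
      length (filter (j <?_) (consPositive p ps)) ≡ suc (length (filter (j <?_) ps))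
    leg-cons {suc _} ps j<p = cong length (List.filter-accept (j <?_) j<p)
  ... | false with m≤n⇒m<n∨m≡n (s≤s⁻¹ j<G)
  -- The position `n` is itself the gap sought: no lower row reaches past column `j`, so arm and leg
  -- vanish and the hook has length 1.
  ...   | inj₂ refl = n , eq , (begin
      n + (gapCount f n ∸ gapCount f n + leg f n j + 1)
        ≡⟨ cong₂ (λ a l → n + (a + l + 1)) (n∸n≡0 (gapCount f n))
             (cong length (filter-parts-above f n ≤-refl)) ⟩
      n + 1
        ≡⟨ +-comm n 1 ⟩
      suc n ∎)
    where open ≡-Reasoning
  -- A gap at `n` beyond the one sought lengthens the arm by one and leaves the leg alone.
  ...   | inj₁ j<G′ =
    let y , fy , y+h≡n = gap-of-column f n j j<G′
    in y , fy , (begin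
      y + (gapCount f n ∸ j + leg f n j + 1)
        ≡⟨ cong (λ a → y + (a + leg f n j + 1)) (+-∸-assoc 1 j<G′) ⟩
      y + (suc (gapCount f n ∸ suc j) + leg f n j + 1)
        ≡⟨ +-suc y _ ⟩
      suc (y + (gapCount f n ∸ suc j + leg f n j + 1))
        ≡⟨ cong suc y+h≡n ⟩
      suc n ∎)
    where open ≡-Reasoning

  -- The bead of the cell's row lies exactly one hook length above the gap of its column. This turns
  -- divisibility of a hook length into a statement about a single runner.
  hook-beadGap : ∀ f n (i : Fin (length (parts f n))) j → j < List.lookup (parts f n) i →
    ∃[ y ] (f y ≡ false × f (y + hookLength (parts f n) i j) ≡ true)
  hook-beadGap f (suc n) i j j<λ with f n in eq
  ... | false = hook-beadGap f n i j j<λ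
  ... | true  = go (gapCount f n) refl i j<λ
    where
    -- Replacing the gap count by a variable `g` lets a match decide whether the bead at `n`
    -- contributes a row at all.
    go : ∀ g → g ≡ gapCount f n → (i : Fin (length (consPositive g (parts f n)))) →
      j < List.lookup (consPositive g (parts f n)) i →
      ∃[ y ] (f y ≡ false × f (y + hookLength (consPositive g (parts f n)) i j) ≡ true)
    go zero    _  i           j<λ = hook-beadGap f n i j j<λ
    go (suc g) eg (Fin.suc i) j<λ = hook-beadGap f n i j j<λ
    go (suc g) eg Fin.zero    j<λ =
      let y , fy , y+h≡n = gap-of-column f n j (subst (j <_) eg j<λ)
      in y , fy , trans (cong f (trans (cong (λ g → y + (g ∸ suc j + leg f n j + 1)) eg) y+h≡n)) eq

  -- Positions of beads in terms of parts

  All≤0⇒[] : ∀ {ps} → All (0 <_) ps → All (_≤ 0) ps → ps ≡ []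
  All≤0⇒[] []      _        = refl
  All≤0⇒[] (p ∷ _) (q ∷ _) = ⊥-elim (<⇒≱ p q)

  -- If `p` is zero, the bound leaves no positive part in `ps`, so the omitted zero is supplied by
  -- the padding of `part`.
  part-consPositive-zero : ∀ p {ps} → All (0 <_) ps → All (_≤ p) ps → part (consPositive p ps) 0 ≡ p
  part-consPositive-zero zero    pos ps≤p rewrite All≤0⇒[] pos ps≤p = refl
  part-consPositive-zero (suc p) pos ps≤p = refl

  part-consPositive-suc : ∀ p {ps} → All (0 <_) ps → All (_≤ p) ps → ∀ i →
    part (consPositive p ps) (suc i) ≡ part ps i
  part-consPositive-suc zero    pos ps≤p i rewrite All≤0⇒[] pos ps≤p = refl
  part-consPositive-suc (suc p) pos ps≤p i = refl

  part-atBead-zero : ∀ f n → part (consPositive (gapCount f n) (parts f n)) 0 ≡ gapCount f n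
  part-atBead-zero f n =
    part-consPositive-zero (gapCount f n) (parts-positive f n) (parts≤gapCount f n)

  part-atBead-suc : ∀ f n i →
    part (consPositive (gapCount f n) (parts f n)) (suc i) ≡ part (parts f n) i
  part-atBead-suc f n =
    part-consPositive-suc (gapCount f n) (parts-positive f n) (parts≤gapCount f n)

  -- The i-th bead from the top (i = 0 for the topmost one) lies at
  -- part i + beadCount - suc i; the terms are arranged to avoid subtraction.
  bead⇒index : ∀ f n d → d < n → f d ≡ true → ∃[ i ] d + suc i ≡ part (parts f n) i + beadCount f n
  bead⇒index f (suc n) d d<1+n fd with m≤n⇒m<n∨m≡n (s≤s⁻¹ d<1+n)
  bead⇒index f (suc n) d d<1+n fd | inj₂ refl rewrite fd = 0 , (begin
    d + 1                               ≡⟨ +-comm d 1 ⟩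
    suc d                               ≡⟨ cong suc (gapCount+beadCount f d) ⟨
    suc (gapCount f d + beadCount f d)  ≡⟨ +-suc _ _ ⟨
    gapCount f d + suc (beadCount f d)  ≡⟨ cong (_+ suc (beadCount f d)) (part-atBead-zero f d) ⟨
    part (consPositive (gapCount f d) (parts f d)) 0 + suc (beadCount f d) ∎)
    where open ≡-Reasoning
  bead⇒index f (suc n) d d<1+n fd | inj₁ d<n with bead⇒index f n d d<n fd
  ... | i , eq with f n
  ...   | false = i , eq
  -- A bead at `n` lies above `d`, so it raises the index of `d` and the bead count by one each.
  ...   | true  = suc i , (begin
    d + suc (suc i)                           ≡⟨ +-suc d (suc i) ⟩
    suc (d + suc i)                           ≡⟨ cong suc eq ⟩
    suc (part (parts f n) i + beadCount f n)  ≡⟨ +-suc _ _ ⟨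
    part (parts f n) i + suc (beadCount f n)  ≡⟨ cong (_+ suc (beadCount f n)) (part-atBead-suc f n i) ⟨
    part (consPositive (gapCount f n) (parts f n)) (suc i) + suc (beadCount f n) ∎)
    where open ≡-Reasoning

  index⇒bead : ∀ f n d i → d + suc i ≡ part (parts f n) i + beadCount f n → f d ≡ true
  -- With nothing read, the right-hand side is zero, while `d + suc i` is positive.
  index⇒bead f zero    d i eq = ⊥-elim (1+n≢0 (trans (sym (+-suc d i)) eq))
  index⇒bead f (suc n) d i eq with f n in fn
  ... | false = index⇒bead f n d i eq
  index⇒bead f (suc n) d zero eq | true = trans (cong f d≡n) fn
    where
    open ≡-Reasoning
    d≡n : d ≡ n
    d≡n = suc-injective (begin
      suc d                               ≡⟨ +-comm 1 d ⟩
      d + 1                               ≡⟨ eq ⟩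
      part (consPositive (gapCount f n) (parts f n)) 0 + suc (beadCount f n)
        ≡⟨ cong (_+ suc (beadCount f n)) (part-atBead-zero f n) ⟩
      gapCount f n + suc (beadCount f n)  ≡⟨ +-suc _ _ ⟩
      suc (gapCount f n + beadCount f n)  ≡⟨ cong suc (gapCount+beadCount f n) ⟩
      suc n ∎)
  index⇒bead f (suc n) d (suc i) eq | true = index⇒bead f n d i (suc-injective (begin
    suc (d + suc i)  ≡⟨ +-suc d (suc i) ⟨
    d + suc (suc i)  ≡⟨ eq ⟩
    part (consPositive (gapCount f n) (parts f n)) (suc i) + suc (beadCount f n)
      ≡⟨ cong (_+ suc (beadCount f n)) (part-atBead-suc f n i) ⟩
    part (parts f n) i + suc (beadCount f n)  ≡⟨ +-suc _ _ ⟩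
    suc (part (parts f n) i + beadCount f n)  ∎))
    where open ≡-Reasoning

  -- The first part as a gap count

  gapCount-step : ∀ f n → gapCount f n ≤ gapCount f (suc n)
  gapCount-step f n with f n
  ... | true  = ≤-refl
  ... | false = n≤1+n _

  gapCount-mono : ∀ f {m n} → m ≤ n → gapCount f m ≤ gapCount f n
  gapCount-mono f m≤n = go (≤⇒≤′ m≤n)
    where
    go : ∀ {m n} → m ≤′ n → gapCount f m ≤ gapCount f n
    go ≤′-refl       = ≤-refl
    go (≤′-step m≤n) = ≤-trans (go m≤n) (gapCount-step f _)

  -- Gap counts grow with the position, so the topmost bead has the largest one, and that is the
  -- first part.
  gapCount≤firstPart : ∀ f n d → d < n → f d ≡ true → gapCount f d ≤ part (parts f n) 0
  gapCount≤firstPart f (suc n) d d<1+n fd with f n in fn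
  ... | true  = subst (gapCount f d ≤_)
    (sym (part-atBead-zero f n))
    (gapCount-mono f (s≤s⁻¹ d<1+n))
  ... | false with m≤n⇒m<n∨m≡n (s≤s⁻¹ d<1+n)
  ...   | inj₁ d<n  = gapCount≤firstPart f n d d<n fd
  ...   | inj₂ refl with () ← trans (sym fd) fn

  -- The first alternative covers a sequence without beads below the bound; otherwise the topmost
  -- bead is the witness.
  firstPart-attained : ∀ f n →
    part (parts f n) 0 ≡ 0 ⊎ ∃[ d ] (f d ≡ true × part (parts f n) 0 ≡ gapCount f d)
  firstPart-attained f zero = inj₁ refl
  firstPart-attained f (suc n) with f n in fn
  ... | true  = inj₂ (n , fn , part-atBead-zero f n)
  ... | false = firstPart-attained f n

  part-zero : ∀ ps i → length ps ≤ i → part ps i ≡ 0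
  part-zero []       i       _   = refl
  part-zero (_ ∷ ps) (suc i) l≤i = part-zero ps i (s≤s⁻¹ l≤i)

  length-parts : ∀ f n → length (parts f n) ≤ beadCount f n
  length-parts f zero = z≤n
  length-parts f (suc n) with f n
  ... | false = length-parts f n
  ... | true with gapCount f n
  ...   | zero  = m≤n⇒m≤1+n (length-parts f n)
  ...   | suc _ = s≤s (length-parts f n)

  -- Indices from `beadCount` on belong to the beads below the window, which have no gap before
  -- them.
  parts-low : ∀ f n k → part (parts f n) (k + beadCount f n) ≡ 0
  parts-low f n k = part-zero (parts f n) _ (≤-trans (length-parts f n) (m≤n+m _ k))

  -- Independence of the window

  gapCount-cong : ∀ {f g} → (∀ d → f d ≡ g d) → ∀ n → gapCount f n ≡ gapCount g n
  gapCount-cong f≗g zero = refl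
  gapCount-cong {f} {g} f≗g (suc n) rewrite f≗g n | gapCount-cong {f} {g} f≗g n = refl

  parts-cong : ∀ {f g} → (∀ d → f d ≡ g d) → ∀ n → parts f n ≡ parts g n
  parts-cong f≗g zero = refl
  parts-cong {f} {g} f≗g (suc n)
    rewrite f≗g n | gapCount-cong {f} {g} f≗g n | parts-cong {f} {g} f≗g n = refl

  gapCount-beads : ∀ f k → (∀ d → d < k → f d ≡ true) → gapCount f k ≡ 0
  gapCount-beads f zero    beads = refl
  gapCount-beads f (suc k) beads rewrite beads k ≤-refl =
    gapCount-beads f k (λ d d<k → beads d (m<n⇒m<1+n d<k))

  module _ (f : ℕ → Bool) (k : ℕ) (beads : ∀ d → d < k → f d ≡ true) where

    gapCount-initialBeads : ∀ n → gapCount f (k + n) ≡ gapCount (f ∘ (_+_ k)) n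
    gapCount-initialBeads zero rewrite +-identityʳ k = gapCount-beads f k beads
    gapCount-initialBeads (suc n) rewrite +-suc k n | gapCount-initialBeads n = refl

    parts-initialBeads : ∀ n → parts f (k + n) ≡ parts (f ∘ (_+_ k)) n
    parts-initialBeads zero rewrite +-identityʳ k = All≤0⇒[] (parts-positive f k)
      (subst (λ g → All (_≤ g) (parts f k)) (gapCount-beads f k beads) (parts≤gapCount f k))
    parts-initialBeads (suc n)
      rewrite +-suc k n | gapCount-initialBeads n | parts-initialBeads n = refl

  parts-finalGaps : ∀ f n → (∀ d → n ≤ d → f d ≡ false) → ∀ k → parts f (k + n) ≡ parts f n
  parts-finalGaps f n gaps zero = refl
  parts-finalGaps f n gaps (suc k) rewrite gaps (k + n) (m≤n+m n k) = parts-finalGaps f n gaps k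

-- The partition of an abacus

open import Data.Integer.Base using (_+_; _-_; -_; _*_; _≤_; _<_; _⊓_; _⊔_)
open import Data.Integer.Tactic.RingSolver using (solve-∀)
open AbelianGroup ℤ.+-0-abelianGroup
  using () renaming (∙-cancelˡ to +-cancelˡ; ∙-cancelʳ to +-cancelʳ)
open Equivalence using (to; from)
private module ⇔ = IsEquivalence (⇔-isEquivalence {0ℓ})

i+j-i≡j : ∀ i j → i + j - i ≡ j
i+j-i≡j = solve-∀

+-swapʳ : ∀ i j k → i + j + k ≡ i + k + j
+-swapʳ = solve-∀

+-swapˡ : ∀ i j k → i + (j + k) ≡ j + (i + k)
+-swapˡ = solve-∀

suc-+ʳ : ∀ i j → sucℤ (i + j) ≡ i + sucℤ j
suc-+ʳ i j = +-swapˡ 1ℤ i j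

offset : ∀ {i j} → i ≤ j → ∃[ n ] j ≡ i + + n
offset {i} {j} i≤j = ∣ j - i ∣ ,
  trans (lemma i j) (cong (_+_ i) (sym (ℤ.0≤i⇒+∣i∣≡i (ℤ.i≤j⇒0≤j-i i≤j))))
  where
  lemma : ∀ i j → j ≡ i + (j - i)
  lemma = solve-∀

indicator : ∀ {ℓ} → Abacus ℓ → ℤ → ℕ → Bool
indicator A m d = does (bead? A (m + + d))

module _ {ℓ} (A : Abacus ℓ) where

  indicator-true : ∀ m d → indicator A m d ≡ true → Bead A (m + + d)
  indicator-true m d eq with bead? A (m + + d)
  ... | yes bead = bead
  indicator-true m d () | no _

  indicator-false : ∀ m d → indicator A m d ≡ false → ¬ Bead A (m + + d)
  indicator-false m d eq with bead? A (m + + d)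
  ... | no gap = gap
  indicator-false m d () | yes _

  gapsBefore-offset : ∀ d → gapsBefore A (lo A + + d) ≡ gapCount (indicator A (lo A)) d
  gapsBefore-offset d = trans
    (cong (λ k → length (filter (gap? A) (map (λ e → lo A + + e) (downFrom (positivePart k)))))
      (i+j-i≡j (lo A) (+ d)))
    (go d)
    where
    go : ∀ n → length (filter (gap? A) (map (λ e → lo A + + e) (downFrom n))) ≡
               gapCount (indicator A (lo A)) n
    go zero = refl
    go (suc n) with does (bead? A (lo A + + n))
    ... | true  = go n
    ... | false = cong suc (go n)

  -- If `hi` were below `lo`, it would be both a bead and a gap.
  lo≤hi : lo A ≤ hi A
  lo≤hi = ℤ.≮⇒≥ λ hi<lo → gaps-high A (hi A) ℤ.≤-refl (beads-low A (hi A) hi<lo)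

  size : ℕ
  size = proj₁ (offset lo≤hi)

  hi≡lo+size : hi A ≡ lo A + + size
  hi≡lo+size = proj₂ (offset lo≤hi)

  -- Windows list integers downwards, so the maps and filters of `partition` fuse into the recursion
  -- of `parts`, which reads the topmost position first.
  partition≡parts : partition A ≡ parts (indicator A (lo A)) size
  partition≡parts = trans
    (cong (λ k → filter (0 ℕ.<?_) (map (gapsBefore A)
      (filter (bead? A) (map (λ e → lo A + + e) (downFrom (positivePart k))))))
      (trans (cong (_- lo A) hi≡lo+size) (i+j-i≡j (lo A) (+ size))))
    (go size)
    where
    filter-positive : ∀ p ps → filter (0 ℕ.<?_) (p ∷ ps) ≡ consPositive p (filter (0 ℕ.<?_) ps)
    filter-positive zero    ps = refl
    filter-positive (suc p) ps = refl
    go : ∀ n → filter (0 ℕ.<?_) (map (gapsBefore A)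
      (filter (bead? A) (map (λ e → lo A + + e) (downFrom n)))) ≡ parts (indicator A (lo A)) n
    go zero = refl
    go (suc n) with does (bead? A (lo A + + n))
    ... | false = go n
    ... | true  = trans (filter-positive (gapsBefore A (lo A + + n)) _)
      (cong₂ consPositive (gapsBefore-offset n) (go n))

  partition-isPartition : IsPartition (partition A)
  partition-isPartition = subst IsPartition (sym partition≡parts) (parts-isPartition _ size)

  -- Enlarging the window adds only beads below and gaps above, and neither adds a part. Hence two
  -- abaci can be compared on matching windows.
  partition-window : ∀ m n → m ≤ lo A → hi A ≤ m + + n → partition A ≡ parts (indicator A m) n
  partition-window m n m≤lo hi≤m+n
    with k , lo≡m+k ← offset m≤lo
    with r , m+n≡hi+r ← offset hi≤m+n = begin
      partition A                                     ≡⟨ partition≡parts ⟩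
      parts (indicator A (lo A)) size                 ≡⟨ parts-cong reindex size ⟩
      parts (indicator A m ∘ (k ℕ.+_)) size           ≡⟨ parts-initialBeads _ k low size ⟨
      parts (indicator A m) (k ℕ.+ size)              ≡⟨ parts-finalGaps _ (k ℕ.+ size) high r ⟨
      parts (indicator A m) (r ℕ.+ (k ℕ.+ size))      ≡⟨ cong (parts _) n≡ ⟨
      parts (indicator A m) n                         ∎
    where
    open ≡-Reasoning
    shift : ∀ d → lo A + + d ≡ m + + (k ℕ.+ d)
    shift d = trans (cong (_+ + d) lo≡m+k) (ℤ.+-assoc m (+ k) (+ d))
    reindex : ∀ d → indicator A (lo A) d ≡ indicator A m (k ℕ.+ d)
    reindex d = cong (does ∘ bead? A) (shift d)
    low : ∀ d → d ℕ.< k → indicator A m d ≡ true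
    low d d<k = dec-true (bead? A _) (beads-low A _
      (subst (m + + d <_) (sym lo≡m+k) (ℤ.+-monoʳ-< m (+<+ d<k))))
    high : ∀ d → k ℕ.+ size ℕ.≤ d → indicator A m d ≡ false
    high d k+N≤d = dec-false (bead? A _) (gaps-high A _
      (subst (_≤ m + + d) (sym (trans hi≡lo+size (shift size))) (ℤ.+-monoʳ-≤ m (+≤+ k+N≤d))))
    n≡ : n ≡ r ℕ.+ (k ℕ.+ size)
    n≡ = ℤ.+-injective (+-cancelˡ m _ _ (begin
      m + + n                        ≡⟨ m+n≡hi+r ⟩
      hi A + + r                     ≡⟨ cong (_+ + r) (trans hi≡lo+size (shift size)) ⟩
      m + + (k ℕ.+ size) + + r       ≡⟨ ℤ.+-assoc m _ _ ⟩
      m + + (k ℕ.+ size ℕ.+ r)       ≡⟨ cong (λ d → m + + d) (ℕ.+-comm (k ℕ.+ size) r) ⟩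
      m + + (r ℕ.+ (k ℕ.+ size))     ∎))

  -- This is where the first gap would stand if all beads were pushed down as far as possible.
  charge : ℤ
  charge = lo A + + beadCount (indicator A (lo A)) size

  -- Thus an abacus is recovered from its partition and its charge.
  bead⇔index : ∀ x → Bead A x ⇔ (∃[ i ] x + + suc i ≡ + part (partition A) i + charge)
  bead⇔index x = mk⇔ index bead
    where
    f = indicator A (lo A)
    B = beadCount f size
    step : ∀ x k b → x + (1ℤ + (k + b)) ≡ 1ℤ + x + k + b
    step = solve-∀

    offset-index : ∀ d i → d ℕ.+ suc i ≡ part (parts f size) i ℕ.+ B →
      lo A + + d + + suc i ≡ + part (partition A) i + charge
    offset-index d i eq = begin
      lo A + + d + + suc i                           ≡⟨ ℤ.+-assoc (lo A) (+ d) (+ suc i) ⟩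
      lo A + + (d ℕ.+ suc i)                         ≡⟨ cong (λ e → lo A + + e) eq ⟩
      lo A + (+ part (parts f size) i + + B)         ≡⟨ +-swapˡ (lo A) (+ part (parts f size) i) (+ B) ⟩
      + part (parts f size) i + charge               ≡⟨ cong (λ ps → + part ps i + charge) partition≡parts ⟨
      + part (partition A) i + charge                ∎
      where open ≡-Reasoning

    index-offset : ∀ d i → lo A + + d + + suc i ≡ + part (partition A) i + charge →
      d ℕ.+ suc i ≡ part (parts f size) i ℕ.+ B
    index-offset d i eq = ℤ.+-injective (+-cancelˡ (lo A) _ _ (begin
      lo A + + (d ℕ.+ suc i)                         ≡⟨ ℤ.+-assoc (lo A) (+ d) (+ suc i) ⟨
      lo A + + d + + suc i                           ≡⟨ eq ⟩
      + part (partition A) i + charge                ≡⟨ cong (λ ps → + part ps i + charge) partition≡parts ⟩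
      + part (parts f size) i + charge               ≡⟨ +-swapˡ (lo A) (+ part (parts f size) i) (+ B) ⟨
      lo A + (+ part (parts f size) i + + B)         ∎))
      where open ≡-Reasoning

    index : Bead A x → ∃[ i ] x + + suc i ≡ + part (partition A) i + charge
    index bead with x ℤ.<? lo A
    -- Above `x` there are `k` entries before `lo`, all of them beads, and then the `B` beads from
    -- `lo` on; hence the index `k + B`, at which the part is zero.
    ... | yes x<lo with k , lo≡x+1+k ← offset (ℤ.i<j⇒suc[i]≤j x<lo) = k ℕ.+ B , (begin
      x + + suc (k ℕ.+ B)                              ≡⟨ step x (+ k) (+ B) ⟩
      sucℤ x + + k + + B                               ≡⟨ cong (_+ + B) lo≡x+1+k ⟨
      charge                                           ≡⟨ ℤ.+-identityˡ charge ⟨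
      0ℤ + charge                                      ≡⟨ cong (λ p → + p + charge) (parts-low f size k) ⟨
      + part (parts f size) (k ℕ.+ B) + charge         ≡⟨ cong (λ ps → + part ps (k ℕ.+ B) + charge) partition≡parts ⟨
      + part (partition A) (k ℕ.+ B) + charge          ∎)
      where open ≡-Reasoning
    ... | no x≮lo with d , refl ← offset (ℤ.≮⇒≥ x≮lo) =
      let d<size = ℕ.≰⇒> λ size≤d → gaps-high A x
            (subst (_≤ x) (sym hi≡lo+size) (ℤ.+-monoʳ-≤ (lo A) (+≤+ size≤d))) bead
          i , eq = bead⇒index f size d d<size (dec-true (bead? A x) bead)
      in i , offset-index d i eq

    bead : ∃[ i ] x + + suc i ≡ + part (partition A) i + charge → Bead A x
    bead (i , eq) with x ℤ.<? lo A
    ... | yes x<lo = beads-low A x x<lo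
    ... | no x≮lo with d , refl ← offset (ℤ.≮⇒≥ x≮lo) =
      indicator-true (lo A) d (index⇒bead f size d i (index-offset d i eq))

-- Equality of partitions as translation of bead sets

Shift : ∀ {ℓ ℓ′} → Abacus ℓ → ℤ → Abacus ℓ′ → Set
Shift A s B = ∀ x → Bead A x ⇔ Bead B (x + s)

partition-shift : ∀ {ℓ ℓ′} {A : Abacus ℓ} {B : Abacus ℓ′} s →
  Shift A s B → partition A ≡ partition B
partition-shift {A = A} {B} s shift = begin
  partition A                   ≡⟨ partition-window A m n
    (ℤ.i⊓j≤i _ _) (ℤ.≤-trans (ℤ.i≤i⊔j _ _) h≤) ⟩
  parts (indicator A m) n       ≡⟨ parts-cong same n ⟩
  parts (indicator B (m + s)) n ≡⟨ partition-window B (m + s) n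
    (subst (m + s ≤_) (cancel (lo B)) (ℤ.+-monoˡ-≤ s (ℤ.i⊓j≤j (lo A) (lo B - s))))
    (subst₂ _≤_ (cancel (hi B)) (+-swapʳ m (+ n) s) (ℤ.+-monoˡ-≤ s (ℤ.≤-trans (ℤ.i≤j⊔i _ _) h≤))) ⟨
  partition B                   ∎
  where
  open ≡-Reasoning
  -- The interval from `m` to `h` contains the window of `A` and, after translation by `s`, that of
  -- `B`.
  m = lo A ⊓ (lo B - s)
  h = hi A ⊔ (hi B - s)
  m≤h : m ≤ h
  m≤h = ℤ.≤-trans (ℤ.i⊓j≤i _ _) (ℤ.≤-trans (lo≤hi A) (ℤ.i≤i⊔j _ _))
  n = proj₁ (offset m≤h)
  h≤ : h ≤ m + + n
  h≤ = ℤ.≤-reflexive (proj₂ (offset m≤h))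
  cancel : ∀ y → y - s + s ≡ y
  cancel y = trans (ℤ.+-assoc y (- s) s) (trans (cong (_+_ y) (ℤ.+-inverseˡ s)) (ℤ.+-identityʳ y))
  same : ∀ d → indicator A m d ≡ indicator B (m + s) d
  same d = trans (does-⇔ (shift (m + + d)) (bead? A _) (bead? B _))
    (cong (does ∘ bead? B) (+-swapʳ m (+ d) s))

-- With equal parts, the equations of `bead⇔index` for `x` in `A` and for `x + s` in `B` differ only
-- by adding `s` on both sides, so the same index solves both.
partition≡⇒shift : ∀ {ℓ ℓ′} (A : Abacus ℓ) (B : Abacus ℓ′) → partition A ≡ partition B →
  Shift A (charge B - charge A) B
partition≡⇒shift A B A≡B x = mk⇔
  (λ bead → let i , eq = to (bead⇔index A x) bead in from (bead⇔index B (x + s)) (i , (begin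
    x + s + + suc i                                 ≡⟨ +-swapʳ x s (+ suc i) ⟩
    x + + suc i + s                                 ≡⟨ cong (_+ s) eq ⟩
    + part (partition A) i + charge A + s           ≡⟨ cancel (+ part (partition A) i) (charge A) (charge B) ⟩
    + part (partition A) i + charge B               ≡⟨ cong (λ ps → + part ps i + charge B) A≡B ⟩
    + part (partition B) i + charge B               ∎)))
  (λ bead → let i , eq = to (bead⇔index B (x + s)) bead in from (bead⇔index A x) (i ,
    +-cancelʳ s _ _ (begin
    x + + suc i + s                                 ≡⟨ +-swapʳ x s (+ suc i) ⟨
    x + s + + suc i                                 ≡⟨ eq ⟩
    + part (partition B) i + charge B               ≡⟨ cong (λ ps → + part ps i + charge B) A≡B ⟨
    + part (partition A) i + charge B               ≡⟨ cancel (+ part (partition A) i) (charge A) (charge B) ⟨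
    + part (partition A) i + charge A + s           ∎)))
  where
  open ≡-Reasoning
  s = charge B - charge A
  cancel : ∀ p a b → p + a + (b - a) ≡ p + b
  cancel = solve-∀

-- Gaps before an entry, and bounds on the first part

module _ {ℓ} (A : Abacus ℓ) where

  gapsBefore-low : ∀ x → x ≤ lo A → gapsBefore A x ≡ 0
  gapsBefore-low x x≤lo with n , lo≡x+n ← offset x≤lo =
    cong (λ k → length (filter (gap? A) (map (λ e → lo A + + e) (downFrom k))))
      (trans (cong positivePart (trans (cong (_-_ x) lo≡x+n) (lemma x (+ n)))) (nonpositive n))
    where
    lemma : ∀ i j → i - (i + j) ≡ - j
    lemma = solve-∀
    nonpositive : ∀ n → positivePart (- (+ n)) ≡ 0
    nonpositive zero    = refl
    nonpositive (suc n) = refl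

  gapsBefore-mono : ∀ {x y} → x ≤ y → gapsBefore A x ℕ.≤ gapsBefore A y
  gapsBefore-mono {x} {y} x≤y with ℤ.≤-total x (lo A)
  ... | inj₁ x≤lo = subst (ℕ._≤ gapsBefore A y) (sym (gapsBefore-low x x≤lo)) ℕ.z≤n
  ... | inj₂ lo≤x with d , refl ← offset lo≤x | e , refl ← offset x≤y =
    subst₂ ℕ._≤_ (sym (gapsBefore-offset A d))
      (sym (trans (cong (gapsBefore A) (ℤ.+-assoc (lo A) (+ d) (+ e)))
        (gapsBefore-offset A (d ℕ.+ e))))
      (gapCount-mono (indicator A (lo A)) (ℕ.m≤m+n d e))

  gapsBefore-suc-gap : ∀ x → ¬ Bead A x → gapsBefore A (sucℤ x) ≡ suc (gapsBefore A x)
  gapsBefore-suc-gap x gap with d , refl ← offset (ℤ.≮⇒≥ (gap ∘ beads-low A x)) = begin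
    gapsBefore A (sucℤ (lo A + + d))        ≡⟨ cong (gapsBefore A) (suc-+ʳ (lo A) (+ d)) ⟩
    gapsBefore A (lo A + + suc d)           ≡⟨ gapsBefore-offset A (suc d) ⟩
    gapCount f (suc d)                      ≡⟨ step ⟩
    suc (gapCount f d)                      ≡⟨ cong suc (gapsBefore-offset A d) ⟨
    suc (gapsBefore A (lo A + + d))         ∎
    where
    open ≡-Reasoning
    f = indicator A (lo A)
    step : gapCount f (suc d) ≡ suc (gapCount f d)
    step rewrite dec-false (bead? A (lo A + + d)) gap = refl

  gapsBefore-suc-bead : ∀ d → Bead A (lo A + + d) →
    gapsBefore A (lo A + + suc d) ≡ gapsBefore A (lo A + + d)
  gapsBefore-suc-bead d bead =
    trans (gapsBefore-offset A (suc d)) (trans step (sym (gapsBefore-offset A d)))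
    where
    f = indicator A (lo A)
    step : gapCount f (suc d) ≡ gapCount f d
    step rewrite dec-true (bead? A (lo A + + d)) bead = refl

  firstPart-partition : firstPart (partition A) ≡ part (parts (indicator A (lo A)) (size A)) 0
  firstPart-partition = trans (firstPart≡part (partition A))
    (cong (λ ps → part ps 0) (partition≡parts A))
    where
    firstPart≡part : ∀ ps → firstPart ps ≡ part ps 0
    firstPart≡part []      = refl
    firstPart≡part (_ ∷ _) = refl

  gapsBefore≤firstPart : ∀ x → Bead A x → gapsBefore A x ℕ.≤ firstPart (partition A)
  gapsBefore≤firstPart x bead with ℤ.≤-total x (lo A)
  ... | inj₁ x≤lo = subst (ℕ._≤ firstPart (partition A)) (sym (gapsBefore-low x x≤lo)) ℕ.z≤n
  ... | inj₂ lo≤x with d , refl ← offset lo≤x =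
    subst₂ ℕ._≤_ (sym (gapsBefore-offset A d))
      (sym firstPart-partition)
      (gapCount≤firstPart _ (size A) d d<size (dec-true (bead? A _) bead))
    where
    d<size : d ℕ.< size A
    d<size = ℕ.≰⇒> λ size≤d → gaps-high A x
      (subst (_≤ x) (sym (hi≡lo+size A)) (ℤ.+-monoʳ-≤ (lo A) (+≤+ size≤d))) bead

  firstPart≡gapsBefore : firstPart (partition A) ≡ 0 ⊎
    ∃[ d ] (Bead A (lo A + + d) × firstPart (partition A) ≡ gapsBefore A (lo A + + d))
  firstPart≡gapsBefore with firstPart-attained (indicator A (lo A)) (size A)
  ... | inj₁ eq            = inj₁ (trans firstPart-partition eq)
  ... | inj₂ (d , fd , eq) = inj₂ (d , indicator-true A (lo A) d fd ,
    trans firstPart-partition (trans eq (sym (gapsBefore-offset A d))))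

-- h embeds the gaps of D below a bead y into the gaps of A below the bead h y.
firstPart-embedding : ∀ {ℓ ℓ′} {D : Abacus ℓ} {A : Abacus ℓ′} (h : ℤ → ℤ) →
  (∀ y → h y < h (sucℤ y)) → (∀ y → Bead D y ⇔ Bead A (h y)) →
  firstPart (partition D) ℕ.≤ firstPart (partition A)
firstPart-embedding {D = D} {A} h h-step beads with firstPart≡gapsBefore D
... | inj₁ eq = subst (ℕ._≤ firstPart (partition A)) (sym eq) ℕ.z≤n
... | inj₂ (d , bead , eq) = begin
  firstPart (partition D)            ≡⟨ eq ⟩
  gapsBefore D (lo D + + d)          ≤⟨ go d ⟩
  gapsBefore A (h (lo D + + d))      ≤⟨ gapsBefore≤firstPart A _ (to (beads _) bead) ⟩
  firstPart (partition A)            ∎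
  where
  open ℕ.≤-Reasoning
  h-suc : ∀ d → h (lo D + + d) < h (lo D + + suc d)
  h-suc d = subst (λ y → h (lo D + + d) < h y) (suc-+ʳ (lo D) (+ d)) (h-step (lo D + + d))
  go : ∀ d → gapsBefore D (lo D + + d) ℕ.≤ gapsBefore A (h (lo D + + d))
  go zero = subst (ℕ._≤ gapsBefore A (h (lo D + + 0))) (sym (gapsBefore-offset D 0)) ℕ.z≤n
  go (suc d) with bead? D (lo D + + d)
  ... | yes bead = begin
    gapsBefore D (lo D + + suc d)        ≡⟨ gapsBefore-suc-bead D d bead ⟩
    gapsBefore D (lo D + + d)            ≤⟨ go d ⟩
    gapsBefore A (h (lo D + + d))        ≤⟨ gapsBefore-mono A (ℤ.<⇒≤ (h-suc d)) ⟩
    gapsBefore A (h (lo D + + suc d))    ∎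
  -- The gap at `lo D + d` is sent by `h` to a gap of `A`, which lies strictly below the next value
  -- of `h` and so is counted there as one more.
  ... | no gap = begin
    gapsBefore D (lo D + + suc d)        ≡⟨ cong (gapsBefore D) (suc-+ʳ (lo D) (+ d)) ⟨
    gapsBefore D (sucℤ (lo D + + d))     ≡⟨ gapsBefore-suc-gap D _ gap ⟩
    suc (gapsBefore D (lo D + + d))      ≤⟨ ℕ.s≤s (go d) ⟩
    suc (gapsBefore A (h (lo D + + d)))  ≡⟨ gapsBefore-suc-gap A _ (gap ∘ from (beads _)) ⟨
    gapsBefore A (sucℤ (h (lo D + + d))) ≤⟨ gapsBefore-mono A (ℤ.i<j⇒suc[i]≤j (h-suc d)) ⟩
    gapsBefore A (h (lo D + + suc d))    ∎

partition-cong : ∀ {ℓ ℓ′} {A : Abacus ℓ} {B : Abacus ℓ′} →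
  (∀ x → Bead A x ⇔ Bead B x) → partition A ≡ partition B
partition-cong {A = A} {B} same = partition-shift {A = A} {B} 0ℤ
  (λ x → subst (λ y → Bead A x ⇔ Bead B y) (sym (ℤ.+-identityʳ x)) (same x))

-- Flush abaci

module _ {ℓ : ℕ} .{{_ : NonZero ℓ}} where

  level-entry : ∀ r (j : Fin ℓ) → level ℓ (entry ℓ r j) ≡ r
  level-entry r j = ℤ.≤-antisym
    (subst (level ℓ (entry ℓ r j) ≤_) (ℤ.pred-suc r) (ℤ.i<j⇒i≤pred[j]
      (level-below _ (sucℤ r) (entry-below r (sucℤ r) j (ℤ.suc[i]≤j⇒i<j ℤ.≤-refl)))))
    (level-above _ r (entry-above r r j ℤ.≤-refl))

  entry-level-runner : ∀ x → entry ℓ (level ℓ x) (runner ℓ x) ≡ x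
  entry-level-runner x = begin
    level ℓ x * + ℓ + + toℕ (runner ℓ x)  ≡⟨ cong (λ d → level ℓ x * + ℓ + + d)
                                                (Fin.toℕ-fromℕ< (n%ℕd<d x ℓ)) ⟩
    level ℓ x * + ℓ + + _                 ≡⟨ ℤ.+-comm (level ℓ x * + ℓ) _ ⟩
    + _ + level ℓ x * + ℓ                 ≡⟨ a≡a%ℕn+[a/ℕn]*n x ℓ ⟨
    x                                     ∎
    where open ≡-Reasoning

  entry-cancel : ∀ r {i j : Fin ℓ} → entry ℓ r i ≡ entry ℓ r j → i ≡ j
  entry-cancel r eq = Fin.toℕ-injective (ℤ.+-injective (+-cancelˡ (r * + ℓ) _ _ eq))

  runner-entry : ∀ r (j : Fin ℓ) → runner ℓ (entry ℓ r j) ≡ j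
  runner-entry r j = entry-cancel r (trans
    (cong (λ s → entry ℓ s (runner ℓ (entry ℓ r j))) (sym (level-entry r j)))
    (entry-level-runner (entry ℓ r j)))

  -- At an `entry`, level and runner are known, so bead conditions of flush abaci become
  -- inequalities between levels.
  entry-elim : ∀ (P : ℤ → Set) → (∀ r j → P (entry ℓ r j)) → ∀ x → P x
  entry-elim P p x = subst P (entry-level-runner x) (p (level ℓ x) (runner ℓ x))

  level-mono : ∀ {x y} → x ≤ y → level ℓ x ≤ level ℓ y
  level-mono {x} {y} x≤y = level-above y (level ℓ x) (ℤ.≤-trans ([n/ℕd]*d≤n x ℓ) x≤y)

  flush-entry : ∀ (a : Vec ℤ ℓ) r j → Bead (flushAbacus a) (entry ℓ r j) ≡ (r ≤ lookup a j)
  flush-entry a r j = cong₂ (λ s i → s ≤ lookup a i) (level-entry r j) (runner-entry r j)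

  flush-bead : ∀ (a : Vec ℤ ℓ) r j → r ≤ lookup a j → Bead (flushAbacus a) (entry ℓ r j)
  flush-bead a r j = subst id (sym (flush-entry a r j))

  flush-level≤ : ∀ (a : Vec ℤ ℓ) r j → Bead (flushAbacus a) (entry ℓ r j) → r ≤ lookup a j
  flush-level≤ a r j = subst id (flush-entry a r j)

  -- A hook of length `q * ℓ` would place a bead `q` levels above a gap of the same runner, contrary
  -- to flushness.
  flush-isCore : ∀ (a : Vec ℤ ℓ) → IsCore ℓ (π a)
  flush-isCore a = partition-isPartition A ,
    subst (λ ps → ∀ i j → j ℕ.< List.lookup ps i → ¬ (ℓ ∣ hookLength ps i j))
      (sym (partition≡parts A)) noHook
    where
    A = flushAbacus a
    f = indicator A (lo A)
    flush : ∀ y q → Bead A (y + + q * + ℓ) → Bead A y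
    flush y q = entry-elim (λ y → Bead A (y + + q * + ℓ) → Bead A y)
      (λ r j bead → flush-bead a r j (ℤ.≤-trans (ℤ.i≤i+j r (+ q))
        (flush-level≤ a (r + + q) j (subst (Bead A) (lemma r (+ toℕ j) (+ q) (+ ℓ)) bead)))) y
      where
      lemma : ∀ r j q l → r * l + j + q * l ≡ (r + q) * l + j
      lemma = solve-∀
    noHook : ∀ i j → j ℕ.< List.lookup (parts f (size A)) i →
      ¬ (ℓ ∣ hookLength (parts f (size A)) i j)
    noHook i j j<λ (divides q h≡qℓ) with y , fy , fy+h ← hook-beadGap f (size A) i j j<λ =
      indicator-false A (lo A) y fy (flush (lo A + + y) q
        (subst (Bead A) reassoc (indicator-true A (lo A) _ fy+h)))
      where
      open ≡-Reasoning
      h = hookLength (parts f (size A)) i j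
      reassoc : lo A + + (y ℕ.+ h) ≡ lo A + + y + + q * + ℓ
      reassoc = begin
        lo A + + (y ℕ.+ h)            ≡⟨ cong (λ k → lo A + + (y ℕ.+ k)) h≡qℓ ⟩
        lo A + (+ y + + (q ℕ.* ℓ))    ≡⟨ cong (λ k → lo A + (+ y + k)) (ℤ.pos-* q ℓ) ⟩
        lo A + (+ y + + q * + ℓ)      ≡⟨ ℤ.+-assoc (lo A) _ _ ⟨
        lo A + + y + + q * + ℓ        ∎

  -- It suffices to test the highest bead of each runner, which lies at level `lookup a j`.
  flush-reflects-≤ : ∀ (a b : Vec ℤ ℓ) →
    (∀ x → Bead (flushAbacus a) x → Bead (flushAbacus b) x) → ∀ j → lookup a j ≤ lookup b j
  flush-reflects-≤ a b a⇒b j = flush-level≤ b (lookup a j) j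
    (a⇒b (entry ℓ (lookup a j) j) (flush-bead a (lookup a j) j ℤ.≤-refl))

  flush-injective : ∀ (a b : Vec ℤ ℓ) →
    (∀ x → Bead (flushAbacus a) x ⇔ Bead (flushAbacus b) x) → a ≡ b
  flush-injective a b same = begin
    a                        ≡⟨ Vec.tabulate∘lookup a ⟨
    Vec.tabulate (lookup a)  ≡⟨ Vec.tabulate-cong (λ j → ℤ.≤-antisym
      (flush-reflects-≤ a b (to ∘ same) j) (flush-reflects-≤ b a (from ∘ same) j)) ⟩
    Vec.tabulate (lookup b)  ≡⟨ Vec.tabulate∘lookup b ⟩
    b                        ∎
    where open ≡-Reasoning

  -- A higher level outweighs any runner, and within one level entries increase to the right; so the
  -- largest bead is on the last of the tallest runners.
  largestBead-runner : ∀ (a : Vec ℤ ℓ) x → IsLargestBead (flushAbacus a) x →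
    IsRightmostMaximum a (runner ℓ x)
  largestBead-runner a x (bead , largest) = max , rightmost
    where
    below : ∀ j → entry ℓ (lookup a j) j ≤ x
    below j = largest _ (flush-bead a (lookup a j) j ℤ.≤-refl)
    ≤level : ∀ j → lookup a j ≤ level ℓ x
    ≤level j = subst (_≤ level ℓ x) (level-entry (lookup a j) j) (level-mono (below j))
    max : ∀ j → lookup a j ≤ lookup a (runner ℓ x)
    max j = ℤ.≤-trans (≤level j) bead
    rightmost : ∀ j → runner ℓ x Fin.< j → lookup a j ≢ lookup a (runner ℓ x)
    rightmost j x<j eq = ℤ.<⇒≱ (ℤ.+-monoʳ-< (lookup a j * + ℓ) (+<+ x<j))
      (subst (entry ℓ (lookup a j) j ≤_)
        (trans (sym (entry-level-runner x)) (cong (λ r → entry ℓ r (runner ℓ x)) level≡))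
        (below j))
      where
      level≡ : level ℓ x ≡ lookup a j
      level≡ = ℤ.≤-antisym (subst (level ℓ x ≤_) (sym eq) bead) (≤level j)

-- Rightmost maxima, ψ and omitted entries

rightmostMaximum-unique : ∀ {m} (a : Vec ℤ m) {i j} →
  IsRightmostMaximum a i → IsRightmostMaximum a j → i ≡ j
rightmostMaximum-unique a {i} {j} (max-i , right-i) (max-j , right-j) with Fin.<-cmp i j
... | tri< i<j _ _ = contradiction (ℤ.≤-antisym (max-i j) (max-j i)) (right-i j i<j)
... | tri≈ _ i≡j _ = i≡j
... | tri> _ _ j<i = contradiction (ℤ.≤-antisym (max-j i) (max-i j)) (right-j i j<i)

lookup-inject₁ : ∀ {n} (a : Vec ℤ (suc n)) j → lookup (init a) j ≡ lookup a (inject₁ j)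
lookup-inject₁ (x ∷ y ∷ a) Fin.zero    = refl
lookup-inject₁ (x ∷ y ∷ a) (Fin.suc j) = lookup-inject₁ (y ∷ a) j

lookup-fromℕ : ∀ {n} (a : Vec ℤ (suc n)) → last a ≡ lookup a (fromℕ n)
lookup-fromℕ (x ∷ [])    = refl
lookup-fromℕ (x ∷ y ∷ a) = lookup-fromℕ (y ∷ a)

lookup-removeAt : ∀ {n} (a : Vec ℤ (suc n)) i j → lookup (removeAt a i) j ≡ lookup a (punchIn i j)
lookup-removeAt (x ∷ a)     Fin.zero    j           = refl
lookup-removeAt (x ∷ y ∷ a) (Fin.suc i) Fin.zero    = refl
lookup-removeAt (x ∷ y ∷ a) (Fin.suc i) (Fin.suc j) = lookup-removeAt (y ∷ a) i j

removeAt-fromℕ : ∀ {n} (a : Vec ℤ (suc n)) → removeAt a (fromℕ n) ≡ init a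
removeAt-fromℕ (x ∷ [])    = refl
removeAt-fromℕ (x ∷ y ∷ a) = cong (x ∷_) (removeAt-fromℕ (y ∷ a))

last-removeAt : ∀ {n} (a : Vec ℤ (suc (suc n))) j → last (removeAt a (inject₁ j)) ≡ last a
last-removeAt (x ∷ y ∷ a)     Fin.zero    = refl
last-removeAt (x ∷ y ∷ z ∷ a) (Fin.suc j) = last-removeAt (y ∷ z ∷ a) j

init-removeAt : ∀ {n} (a : Vec ℤ (suc (suc n))) j →
  init (removeAt a (inject₁ j)) ≡ removeAt (init a) j
init-removeAt (x ∷ y ∷ a)     Fin.zero    = refl
init-removeAt (x ∷ y ∷ z ∷ a) (Fin.suc j) = cong (x ∷_) (init-removeAt (y ∷ z ∷ a) j)

sum-init-last : ∀ {n} (a : Vec ℤ (suc n)) → sum a ≡ last a + sum (init a)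
sum-init-last (x ∷ [])    = refl
sum-init-last (x ∷ y ∷ a) = trans (cong (_+_ x) (sum-init-last (y ∷ a)))
  (+-swapˡ x (last (y ∷ a)) (sum (init (y ∷ a))))

sum-removeAt : ∀ {n} (a : Vec ℤ (suc n)) i → sum a ≡ lookup a i + sum (removeAt a i)
sum-removeAt (x ∷ a)     Fin.zero    = refl
sum-removeAt (x ∷ y ∷ a) (Fin.suc i) = trans (cong (_+_ x) (sum-removeAt (y ∷ a) i))
  (+-swapˡ x (lookup (y ∷ a) i) (sum (removeAt (y ∷ a) i)))

sum-nonpositive : ∀ {n} (a : Vec ℤ n) → (∀ j → lookup a j ≤ 0ℤ) → sum a ≤ 0ℤ
sum-nonpositive []      _   = ℤ.≤-refl
sum-nonpositive (x ∷ a) a≤0 = ℤ.+-mono-≤ (a≤0 Fin.zero) (sum-nonpositive a (a≤0 ∘ Fin.suc))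

sum-ψ : ∀ {n} (a : Vec ℤ (suc n)) → sum (ψ a) ≡ sum a + 1ℤ
sum-ψ a = trans (+-swapʳ (last a) 1ℤ (sum (init a))) (cong (_+ 1ℤ) (sym (sum-init-last a)))

sum-iterate-ψ : ∀ {n} e (a : Vec ℤ (suc n)) → sum (iterate ψ a e) ≡ sum a + + e
sum-iterate-ψ zero    a = sym (ℤ.+-identityʳ (sum a))
sum-iterate-ψ (suc e) a = trans (sum-iterate-ψ e (ψ a))
  (trans (cong (_+ + e) (sum-ψ a)) (ℤ.+-assoc (sum a) 1ℤ (+ e)))

iterate-ψ-surjective : ∀ {n} e (a : Vec ℤ (suc n)) → ∃[ b ] iterate ψ b e ≡ a
iterate-ψ-surjective zero    a = a , refl
iterate-ψ-surjective (suc e) a with iterate-ψ-surjective e a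
-- The inverse of `ψ` moves the first entry to the end and lowers it by 1.
... | x ∷ b , eq = b ∷ʳ (x - 1ℤ) , trans (cong (λ c → iterate ψ c e) (cong₂ _∷_
  (trans (cong (_+ 1ℤ) (Vec.last-∷ʳ (x - 1ℤ) b)) (lemma x))
  (Vec.init-∷ʳ (x - 1ℤ) b))) eq
  where
  lemma : ∀ x → x - 1ℤ + 1ℤ ≡ x
  lemma = solve-∀

-- The successor of the last entry of a level is the first entry of the next:
-- this is where the summand 1 in ψ comes from.
ψ-shift : ∀ {n} (a : Vec ℤ (suc n)) → Shift (flushAbacus a) 1ℤ (flushAbacus (ψ a))
ψ-shift {n} a = entry-elim (λ x → Bead (flushAbacus a) x ⇔ Bead (flushAbacus (ψ a)) (x + 1ℤ)) go
  where
  across : ∀ r l → r * (1ℤ + l) + l + 1ℤ ≡ (r + 1ℤ) * (1ℤ + l) + 0ℤ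
  across = solve-∀
  transport : ∀ r s i j → entry (suc n) r i + 1ℤ ≡ entry (suc n) s j →
    (r ≤ lookup a i ⇔ s ≤ lookup (ψ a) j) →
    Bead (flushAbacus a) (entry (suc n) r i) ⇔ Bead (flushAbacus (ψ a)) (entry (suc n) r i + 1ℤ)
  transport r s i j eq = subst₂ _⇔_ (sym (flush-entry a r i))
    (trans (sym (flush-entry (ψ a) s j)) (cong (Bead (flushAbacus (ψ a))) (sym eq)))
  go : ∀ r i → Bead (flushAbacus a) (entry (suc n) r i) ⇔
               Bead (flushAbacus (ψ a)) (entry (suc n) r i + 1ℤ)
  go r i with view i
  ... | ‵inject₁ j = transport r r (inject₁ j) (Fin.suc j)
    (trans (cong (λ k → r * + suc n + + k + 1ℤ) (Fin.toℕ-inject₁ j)) (trans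
      (ℤ.+-assoc (r * + suc n) (+ toℕ j) 1ℤ) (cong (_+_ (r * + suc n)) (ℤ.+-comm (+ toℕ j) 1ℤ))))
    (subst (λ c → r ≤ c ⇔ r ≤ lookup (init a) j) (lookup-inject₁ a j) ⇔.refl)
  ... | ‵fromℕ = transport r (r + 1ℤ) (fromℕ n) Fin.zero
    (trans (cong (λ k → r * + suc n + + k + 1ℤ) (Fin.toℕ-fromℕ n)) (across r (+ n)))
    (subst (λ c → r ≤ c ⇔ r + 1ℤ ≤ last a + 1ℤ) (lookup-fromℕ a)
      (mk⇔ (ℤ.+-monoˡ-≤ 1ℤ) λ r+1≤ → ℤ.≮⇒≥ λ l<r → ℤ.<⇒≱ (ℤ.+-monoˡ-< 1ℤ l<r) r+1≤))

-- Orbits of `ψ` as families of translates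

iterate-ψ-shift : ∀ {n} e (a : Vec ℤ (suc n)) →
  Shift (flushAbacus a) (+ e) (flushAbacus (iterate ψ a e))
iterate-ψ-shift zero    a x =
  subst (λ y → Bead (flushAbacus a) x ⇔ Bead (flushAbacus a) y) (sym (ℤ.+-identityʳ x)) ⇔.refl
iterate-ψ-shift (suc e) a x =
  subst (λ y → Bead (flushAbacus a) x ⇔ Bead (flushAbacus (iterate ψ (ψ a) e)) y)
    (ℤ.+-assoc x 1ℤ (+ e))
    (⇔.trans (ψ-shift a x) (iterate-ψ-shift e (ψ a) (x + 1ℤ)))

π-iterate-ψ : ∀ {n} e (a : Vec ℤ (suc n)) → π (iterate ψ a e) ≡ π a
π-iterate-ψ e a = sym (partition-shift {A = flushAbacus a} {B = flushAbacus (iterate ψ a e)} (+ e)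
  (iterate-ψ-shift e a))

-- A shift `s ≥ 0` from `A` to the flush abacus is undone by stepping back along the orbit of `a`, a
-- negative one by stepping forward. The disjunction records the direction and so avoids negative
-- powers of `ψ`.
shift-of-flush : ∀ {ℓ n} {A : Abacus ℓ} s (a : Vec ℤ (suc n)) → Shift A s (flushAbacus a) →
  ∃[ b ] ((∀ x → Bead A x ⇔ Bead (flushAbacus b) x) ×
    ∃[ e ] (iterate ψ b e ≡ a ⊎ iterate ψ a e ≡ b))
shift-of-flush (+ e) a shift with b , refl ← iterate-ψ-surjective e a =
  b , (λ x → ⇔.trans (shift x) (⇔.sym (iterate-ψ-shift e b x))) , e , inj₁ refl
shift-of-flush {A = A} s@(-[1+ e ]) a shift = iterate ψ a (suc e) , (λ x →
  subst (λ y → Bead A x ⇔ Bead (flushAbacus (iterate ψ a (suc e))) y) (cancel x (+ suc e))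
    (⇔.trans (shift x) (iterate-ψ-shift (suc e) a (x + s)))) , suc e , inj₂ refl
  where
  cancel : ∀ x k → x + - k + k ≡ x
  cancel = solve-∀

-- Each step raises the sum by 1, so two balanced vectors can only be zero steps apart.
iterate-ψ-balanced : ∀ {n} e (v w : Vec ℤ (suc n)) → sum v ≡ 0ℤ → sum w ≡ 0ℤ →
  iterate ψ v e ≡ w → v ≡ w
iterate-ψ-balanced zero    v w sum-v sum-w eq = eq
iterate-ψ-balanced (suc e) v w sum-v sum-w eq
  with () ← trans (sym sum-w) (trans (cong sum (sym eq))
              (trans (sum-iterate-ψ (suc e) v) (cong (_+ + suc e) sum-v)))

-- Vectors with the same image under π lie in one orbit of ψ, which raises the
-- sum by 1.
π-injective : ∀ {n} (v w : Vec ℤ (suc n)) → sum v ≡ 0ℤ → sum w ≡ 0ℤ → π v ≡ π w → v ≡ w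
π-injective v w sum-v sum-w πv≡πw
  with b , same , e , orbit ← shift-of-flush {A = flushAbacus v} _ w
         (partition≡⇒shift (flushAbacus v) (flushAbacus w) πv≡πw)
  with refl ← flush-injective v b same
  with orbit
... | inj₁ eq = iterate-ψ-balanced e v w sum-v sum-w eq
... | inj₂ eq = sym (iterate-ψ-balanced e w v sum-w sum-v eq)

-- A maximum in last place moves to the front, and omitting it leaves the same vector before and
-- after. A maximum elsewhere moves one place to the right, and omitting it commutes with `ψ`, under
-- which `π` is invariant.
ψ-rightmostMaximum : ∀ {n} (a : Vec ℤ (suc (suc n))) i → IsRightmostMaximum a i →
  ∃[ j ] (IsRightmostMaximum (ψ a) j × π (removeAt (ψ a) j) ≡ π (removeAt a i))
ψ-rightmostMaximum {n} a i (max , right) with view i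
... | ‵fromℕ = Fin.zero , (max′ , right′) , cong π (sym (removeAt-fromℕ a))
  where
  -- The increment makes the moved maximum strictly larger than all others, so it is the rightmost
  -- one even at the front.
  init<last : ∀ j → lookup (init a) j < last a + 1ℤ
  init<last j = subst₂ _<_ (sym (lookup-inject₁ a j))
    (trans (ℤ.+-comm 1ℤ (lookup a (fromℕ (suc n)))) (cong (_+ 1ℤ) (sym (lookup-fromℕ a))))
    (ℤ.≤-<-trans (max (inject₁ j)) (ℤ.suc[i]≤j⇒i<j ℤ.≤-refl))
  max′ : ∀ j → lookup (ψ a) j ≤ last a + 1ℤ
  max′ Fin.zero    = ℤ.≤-refl
  max′ (Fin.suc j) = ℤ.<⇒≤ (init<last j)
  right′ : ∀ j → Fin.zero {suc n} Fin.< j → lookup (ψ a) j ≢ last a + 1ℤ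
  right′ (Fin.suc j) _ = ℤ.<⇒≢ (init<last j)
... | ‵inject₁ i′ = Fin.suc i′ , (max′ , right′) ,
  trans (cong π (remove-suc a)) (π-iterate-ψ 1 (removeAt a (inject₁ i′)))
  where
  i≡ : lookup (init a) i′ ≡ lookup a (inject₁ i′)
  i≡ = lookup-inject₁ a i′
  -- The last entry lies to the right of the rightmost maximum and is therefore strictly smaller.
  -- Raised by 1 it can at most tie, and at the front a tie does no harm.
  last≢ : last a ≢ lookup a (inject₁ i′)
  last≢ = subst (_≢ lookup a (inject₁ i′)) (sym (lookup-fromℕ a))
    (right (fromℕ (suc n))
      (subst (toℕ (inject₁ i′) ℕ.<_) (sym (Fin.toℕ-fromℕ (suc n))) (Fin.inject₁ℕ< i′)))
  max′ : ∀ j → lookup (ψ a) j ≤ lookup (init a) i′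
  max′ Fin.zero    = subst₂ _≤_ (ℤ.+-comm 1ℤ (last a)) (sym i≡) (ℤ.i<j⇒suc[i]≤j
    (ℤ.≤∧≢⇒< (subst (_≤ lookup a (inject₁ i′)) (sym (lookup-fromℕ a)) (max (fromℕ (suc n)))) last≢))
  max′ (Fin.suc j) = subst₂ _≤_ (sym (lookup-inject₁ a j)) (sym i≡) (max (inject₁ j))
  right′ : ∀ j → Fin.suc i′ Fin.< j → lookup (ψ a) j ≢ lookup (init a) i′
  right′ (Fin.suc j) i<j eq = right (inject₁ j)
    (subst₂ ℕ._<_ (sym (Fin.toℕ-inject₁ i′)) (sym (Fin.toℕ-inject₁ j)) (ℕ.s≤s⁻¹ i<j))
    (trans (sym (lookup-inject₁ a j)) (trans eq i≡))
  remove-suc : ∀ a → removeAt (ψ a) (Fin.suc i′) ≡ ψ (removeAt a (inject₁ i′))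
  remove-suc a@(x ∷ y ∷ _) =
    cong₂ _∷_ (cong (_+ 1ℤ) (sym (last-removeAt a i′))) (sym (init-removeAt a i′))

iterate-ψ-rightmostMaximum : ∀ {n} e (a : Vec ℤ (suc (suc n))) i j →
  IsRightmostMaximum a i → IsRightmostMaximum (iterate ψ a e) j →
  π (removeAt (iterate ψ a e) j) ≡ π (removeAt a i)
iterate-ψ-rightmostMaximum zero a i j rm-i rm-j =
  cong (λ k → π (removeAt a k)) (rightmostMaximum-unique a rm-j rm-i)
iterate-ψ-rightmostMaximum (suc e) a i j rm-i rm-j
  with k , rm-k , eq ← ψ-rightmostMaximum a i rm-i =
  trans (iterate-ψ-rightmostMaximum e (ψ a) k j rm-k rm-j) eq

-- Deleting a runner of a flush abacus

module _ {n : ℕ} (a : Vec ℤ (suc (suc n))) (i : Fin (suc (suc n))) where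

  -- The number that the runner-deleted abacus renumbers as y.
  undelete : ℤ → ℤ
  undelete y = entry (suc (suc n)) (level (suc n) y) (punchIn i (runner (suc n) y))

  removeAt-bead : ∀ y → Bead (flushAbacus (removeAt a i)) y ⇔ Bead (flushAbacus a) (undelete y)
  removeAt-bead y = ⇔.reflexive (trans
    (cong (level (suc n) y ≤_) (lookup-removeAt a i (runner (suc n) y)))
    (sym (flush-entry a (level (suc n) y) (punchIn i (runner (suc n) y)))))

  undelete-entry : ∀ r j → undelete (entry (suc n) r j) ≡ entry (suc (suc n)) r (punchIn i j)
  undelete-entry r j = cong₂ (λ s k → entry (suc (suc n)) s (punchIn i k))
    (level-entry r j) (runner-entry r j)

  -- Within a level `punchIn` preserves the order of runners, and at the end of a level any runner
  -- of the next one is larger. So `undelete` fits `firstPart-embedding`.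
  undelete-step : ∀ y → undelete y < undelete (sucℤ y)
  undelete-step = entry-elim (λ y → undelete y < undelete (sucℤ y)) go
    where
    across : ∀ r l → 1ℤ + (r * (1ℤ + l) + l) ≡ (1ℤ + r) * (1ℤ + l) + 0ℤ
    across = solve-∀
    transport : ∀ r s j k → sucℤ (entry (suc n) r j) ≡ entry (suc n) s k →
      entry (suc (suc n)) r (punchIn i j) < entry (suc (suc n)) s (punchIn i k) →
      undelete (entry (suc n) r j) < undelete (sucℤ (entry (suc n) r j))
    transport r s j k eq = subst₂ _<_ (sym (undelete-entry r j))
      (trans (sym (undelete-entry s k)) (cong undelete (sym eq)))
    go : ∀ r j → undelete (entry (suc n) r j) < undelete (sucℤ (entry (suc n) r j))
    go r j with view j
    ... | ‵inject₁ k = transport r r (inject₁ k) (Fin.suc k)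
      (trans (cong (λ d → 1ℤ + (r * + suc n + + d)) (Fin.toℕ-inject₁ k))
        (suc-+ʳ (r * + suc n) (+ toℕ k)))
      (ℤ.+-monoʳ-< (r * + suc (suc n)) (+<+ (ℕ.≰⇒> λ k+1≤k →
        ℕ.<⇒≱ (subst (ℕ._< suc (toℕ k)) (sym (Fin.toℕ-inject₁ k)) ℕ.≤-refl)
          (Fin.punchIn-cancel-≤ i (Fin.suc k) (inject₁ k) k+1≤k))))
    ... | ‵fromℕ = transport r (sucℤ r) (fromℕ n) Fin.zero
      (trans (cong (λ d → 1ℤ + (r * + suc n + + d)) (Fin.toℕ-fromℕ n)) (across r (+ n)))
      (ℤ.<-≤-trans (entry-below r (sucℤ r) (punchIn i (fromℕ n)) (ℤ.suc[i]≤j⇒i<j ℤ.≤-refl))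
        (entry-above (sucℤ r) (sucℤ r) (punchIn i Fin.zero) ℤ.≤-refl))

  firstPart-removeAt : firstPart (π (removeAt a i)) ℕ.≤ firstPart (π a)
  firstPart-removeAt = firstPart-embedding {D = flushAbacus (removeAt a i)} {A = flushAbacus a}
    undelete undelete-step removeAt-bead

  partition-deleteRunner : ∀ (A : Abacus (suc (suc n))) →
    (∀ x → Bead A x ⇔ Bead (flushAbacus a) x) →
    partition (deleteRunner i A) ≡ π (removeAt a i)
  partition-deleteRunner A same =
    -- A bead of `deleteRunner i A` at `y` is by definition a bead of `A` at `undelete y`.
    partition-cong {A = deleteRunner i A} {B = flushAbacus (removeAt a i)}
      (λ y → ⇔.trans (same (undelete y)) (⇔.sym (removeAt-bead y)))

-- Arbitrary abaci of the core, and the balanced representative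

partition-deleteLargest : ∀ {n} (a : Vec ℤ (suc (suc n))) i → IsRightmostMaximum a i →
  ∀ (A : Abacus (suc (suc n))) → partition A ≡ π a → ∀ b → IsLargestBead A b →
  partition (deleteRunner (runner (suc (suc n)) b) A) ≡ π (removeAt a i)
partition-deleteLargest {n} a i rm A A≡a x (bead , largest)
  with b , same , e , orbit ← shift-of-flush {A = A} _ a (partition≡⇒shift A (flushAbacus a) A≡a) =
  trans (partition-deleteRunner b j A same) (along orbit)
  where
  j = runner (suc (suc n)) x
  rm-b : IsRightmostMaximum b j
  rm-b = largestBead-runner b x (to (same x) bead , λ y → largest y ∘ from (same y))
  -- Either of `a` and `b` may come first in the orbit; invariance from the earlier to the later one
  -- settles both cases.
  along : iterate ψ b e ≡ a ⊎ iterate ψ a e ≡ b → π (removeAt b j) ≡ π (removeAt a i)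
  along (inj₁ refl) = sym (iterate-ψ-rightmostMaximum e b j i rm-b rm)
  along (inj₂ refl) = iterate-ψ-rightmostMaximum e a i j rm rm-b

-- If the largest entry were negative, all entries and hence their sum would be. Thus the exponent
-- of `ψ` is a natural number.
maximum-nonnegative : ∀ {n} (a : Vec ℤ (suc n)) i → (∀ j → lookup a j ≤ lookup a i) →
  sum a ≡ 0ℤ → 0ℤ ≤ lookup a i
maximum-nonnegative a i max sum-a = ℤ.≮⇒≥ λ aᵢ<0 → ℤ.<-irrefl sum-a
  (subst (_< 0ℤ) (sym (sum-removeAt a i)) (ℤ.+-mono-<-≤ aᵢ<0 (sum-nonpositive (removeAt a i)
    (λ j → subst (_≤ 0ℤ) (sym (lookup-removeAt a i j))
      (ℤ.≤-trans (max (punchIn i j)) (ℤ.<⇒≤ aᵢ<0))))))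

theorem4p4p1p1 : ∀ (n : ℕ) (a : Vec ℤ (suc (suc n))) → sum a ≡ 0ℤ →
    ∀ (k : ℕ) → firstPart (π a) ≡ k →
    ∀ (i : Fin (suc (suc n))) → IsRightmostMaximum a i →
    ∃[ e ] (lookup a i ≡ + e ×
    ∃[ μ ] (Φ (suc n) k (π a) μ × iterate ψ (removeAt a i) e ≡π⁻¹ μ))
theorem4p4p1p1 n a sum-a k refl i rm@(max , _)
  -- The exponent is obtained as the distance of the maximum from zero.
  with e , aᵢ≡0+e ← offset (maximum-nonnegative a i max sum-a) =
  e , aᵢ≡e , π (removeAt a i) ,
  record
    { source = flush-isCore a , refl
    ; target = flush-isCore (removeAt a i) , firstPart-removeAt a i
    ; delete = partition-deleteLargest a i rm
    } ,
  record
    { sum≡0  = sum-v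
    ; π≡     = π-v
    ; unique = λ w sum-w πw≡μ → π-injective w v sum-w sum-v (trans πw≡μ (sym π-v))
    }
  where
  v = iterate ψ (removeAt a i) e
  aᵢ≡e : lookup a i ≡ + e
  aᵢ≡e = trans aᵢ≡0+e (ℤ.+-identityˡ (+ e))
  π-v : π v ≡ π (removeAt a i)
  π-v = π-iterate-ψ e (removeAt a i)
  sum-v : sum v ≡ 0ℤ
  sum-v = begin
    sum v                               ≡⟨ sum-iterate-ψ e (removeAt a i) ⟩
    sum (removeAt a i) + + e            ≡⟨ ℤ.+-comm (sum (removeAt a i)) (+ e) ⟩
    + e + sum (removeAt a i)            ≡⟨ cong (_+ sum (removeAt a i)) aᵢ≡e ⟨
    lookup a i + sum (removeAt a i)     ≡⟨ sum-removeAt a i ⟨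
    sum a                               ≡⟨ sum-a ⟩
    0ℤ                                  ∎
    where open ≡-Reasoning
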